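{- Let $(\mathcal{C},\mathcal{M})$ be a weak adhesive HLR category such that $\mathcal{C}$ has (binary) coproducts compatible with $\mathcal{M}$, i.e., $f+g\in\mathcal{M}$ whenever $f,g\in\mathcal{M}$. Let $\rho_1$ and $\rho_2$ be $\mathcal{M}$-weak spans in $\mathcal{C}$, let $G$ and $H'$ be objects of $\mathcal{C}$, and let $\gamma_1\in\Delta(G,\rho_1)$ and $\gamma_2\in\Delta(G,\rho_2)$ be parallel independent direct transformations; let $H_1$ be the result of $\gamma_1$, i.e., $G\Rightarrow_{\gamma_1}H_1$. If there is a parallel coherent transformation of $G$ by $\gamma_1,\gamma_2$ with result $H'$ (written $G\Rightarrow_{\{\gamma_1,\gamma_2\}}H'$), then there exists a direct transformation $\gamma'_2\in\Delta(H_1,\rho_2)$ with result $H'$, so that $G\Rightarrow_{\gamma_1}H_1\Rightarrow_{\gamma'_2}H'$.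
   Context: Weak adhesive HLR category: a category $\mathcal{C}$ with a class $\mathcal{M}$ of monomorphisms such that (1) $\mathcal{M}$ contains all isomorphisms, is closed under composition, and under decomposition ($g\circ f\in\mathcal{M}$ and $g\in\mathcal{M}$ imply $f\in\mathcal{M}$); (2) $\mathcal{C}$ has pushouts and pullbacks along $\mathcal{M}$-morphisms, and $\mathcal{M}$ is stable under pushouts and pullbacks; (3) pushouts along $\mathcal{M}$-morphisms are weak van Kampen squares: given a pushout of $m:A\to B$, $f:A\to C$ with $m\in\mathcal{M}$ and pushout object $D$, and any commutative cube with this square as bottom face, vertical morphisms $a:A'\to A$, $b:B'\to B$, $c:C'\to C$, $d:D'\to D$, whose two back faces (those containing $a$) are pullbacks, and such that $f\in\mathcal{M}$ or $b,c,d\in\mathcal{M}$, the top face is a pushout if and only if the two front faces are pullbacks. Weak spans: a weak span $\rho$ is a diagram $L\xleftarrow{l}K\xleftarrow{i}I\xrightarrow{r}R$ in $\mathcal{C}$; it is an $\mathcal{M}$-weak span if $l,i,r\in\mathcal{M}$. For an object $G$, a direct transformation $\gamma$ of $G$ by $\rho$, with result $H$ (written $G\Rightarrow_\gamma H$), consists of $\rho$ together with objects $D,H$ and morphisms $m:L\to G$, $k:K\to D$, $f:D\to G$, $g:D\to H$, $n:R\to H$ such that $(G,f,m)$ is a pushout of $(l,k)$ (with $m\circ l=f\circ k$) and $(H,g,n)$ is a pushout of $(r,k\circ i)$ (with $n\circ r=g\circ k\circ i$). $\Delta(G,\rho)$ is the set of direct transformations of $G$ by $\rho$. The data of $\rho_a$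 and $\gamma_a$ are denoted by the same letters indexed by $a$. Parallel independence: $\gamma_1,\gamma_2$ are parallel independent if there exist morphisms $j_1:L_1\to D_2$ and $j_2:L_2\to D_1$ with $f_2\circ j_1=m_1$ and $f_1\circ j_2=m_2$. Parallel coherence: $\gamma_1,\gamma_2$ are parallel coherent if there exist $j_1^2:I_1\to D_2$ and $j_2^1:I_2\to D_1$ with $f_2\circ j_1^2=f_1\circ k_1\circ i_1$ and $f_1\circ j_2^1=f_2\circ k_2\circ i_2$. (Parallel independent implies parallel coherent, via $j_1\circ l_1\circ i_1$ and $j_2\circ l_2\circ i_2$.) Parallel coherent transformation of $G$ by a parallel coherent pair $\gamma_1,\gamma_2$, with result $H'$: with morphisms $j_1^2:I_1\to D_2$ and $j_2^1:I_2\to D_1$ satisfying $f_2\circ j_1^2=f_1\circ k_1\circ i_1$ and $f_1\circ j_2^1=f_2\circ k_2\circ i_2$, and with $j_a^a=k_a\circ i_a$ for $a=1,2$, it consists of a pullback $(D',e_1,e_2)$ of $(f_1,f_2)$ with $e_a:D'\to D_a$; for $c=1,2$ the unique morphism $d_c:I_c\to D'$ with $e_a\circ d_c=j_c^a$ for $a=1,2$; for $a=1,2$ a pushout $(H'_a,g'_a,n'_a)$ of $(r_a,d_a)$, with $g'_a:D'\to H'_a$, $n'_a:R_a\to H'_a$; and a pushout $(H',h_1,h_2)$ of $(g'_1,g'_2)$. -}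

module Defs where

open import Level using (Level; _⊔_; suc)
open import Data.Product using (_×_)
open import Data.Sum using (_⊎_)
open import Function.Bundles using (_⇔_)
open import Relation.Binary.Core using (Rel)
open import Relation.Binary.Structures using (IsEquivalence)

private
  variable
    o ℓ e p : Level

-- Equality of parallel morphisms is an arbitrary equivalence _≈_, as there are
-- no quotient types; objects are never compared for equality.
record Category (o ℓ e : Level) : Set (suc (o ⊔ ℓ ⊔ e)) where
  infix  4 _≈_ _⇒_
  infixr 9 _∘_
  field
    Obj       : Set o
    _⇒_       : Obj → Obj → Set ℓ
    _≈_       : ∀ {A B} → Rel (A ⇒ B) e
    id        : ∀ {A} → A ⇒ A
    _∘_       : ∀ {A B C} → B ⇒ C → A ⇒ B → A ⇒ C
    equiv     : ∀ {A B} → IsEquivalence (_≈_ {A} {B})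
    ∘-resp-≈  : ∀ {A B C} {f h : B ⇒ C} {g k : A ⇒ B} →
                f ≈ h → g ≈ k → f ∘ g ≈ h ∘ k
    assoc     : ∀ {A B C D} {f : A ⇒ B} {g : B ⇒ C} {h : C ⇒ D} →
                (h ∘ g) ∘ f ≈ h ∘ (g ∘ f)
    identityˡ : ∀ {A B} {f : A ⇒ B} → id ∘ f ≈ f
    identityʳ : ∀ {A B} {f : A ⇒ B} → f ∘ id ≈ f

module _ (𝓒 : Category o ℓ e) where
  open Category 𝓒

  Mono : ∀ {A B} → A ⇒ B → Set (o ⊔ ℓ ⊔ e)
  Mono {A} f = ∀ {X} (g h : X ⇒ A) → f ∘ g ≈ f ∘ h → g ≈ h

  record IsIso {A B : Obj} (f : A ⇒ B) : Set (ℓ ⊔ e) where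
    field
      inv  : B ⇒ A
      isoˡ : inv ∘ f ≈ id
      isoʳ : f ∘ inv ≈ id

  --     f
  --  A ----> B
  --  |g      |i₁
  --  v       v
  --  C ----> D
  --     i₂
  record IsPushout {A B C D : Obj} (f : A ⇒ B) (g : A ⇒ C)
                   (i₁ : B ⇒ D) (i₂ : C ⇒ D) : Set (o ⊔ ℓ ⊔ e) where
    field
      commute             : i₁ ∘ f ≈ i₂ ∘ g
      universal           : ∀ {X} (h₁ : B ⇒ X) (h₂ : C ⇒ X) →
                            h₁ ∘ f ≈ h₂ ∘ g → D ⇒ X
      universal∘i₁≈h₁     : ∀ {X} {h₁ : B ⇒ X} {h₂ : C ⇒ X}
                            (eq : h₁ ∘ f ≈ h₂ ∘ g) →
                            universal h₁ h₂ eq ∘ i₁ ≈ h₁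
      universal∘i₂≈h₂     : ∀ {X} {h₁ : B ⇒ X} {h₂ : C ⇒ X}
                            (eq : h₁ ∘ f ≈ h₂ ∘ g) →
                            universal h₁ h₂ eq ∘ i₂ ≈ h₂
      unique              : ∀ {X} {h₁ : B ⇒ X} {h₂ : C ⇒ X} {u : D ⇒ X}
                            (eq : h₁ ∘ f ≈ h₂ ∘ g) →
                            u ∘ i₁ ≈ h₁ → u ∘ i₂ ≈ h₂ →
                            u ≈ universal h₁ h₂ eq

  record Pushout {A B C : Obj} (f : A ⇒ B) (g : A ⇒ C) : Set (o ⊔ ℓ ⊔ e) where
    field
      {D}       : Obj
      i₁        : B ⇒ D
      i₂        : C ⇒ D
      isPushout : IsPushout f g i₁ i₂

  --     p₁
  --  P ----> X
  --  |p₂     |f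
  --  v       v
  --  Y ----> Z
  --     g
  record IsPullback {P X Y Z : Obj} (p₁ : P ⇒ X) (p₂ : P ⇒ Y)
                    (f : X ⇒ Z) (g : Y ⇒ Z) : Set (o ⊔ ℓ ⊔ e) where
    field
      commute             : f ∘ p₁ ≈ g ∘ p₂
      universal           : ∀ {A} (h₁ : A ⇒ X) (h₂ : A ⇒ Y) →
                            f ∘ h₁ ≈ g ∘ h₂ → A ⇒ P
      p₁∘universal≈h₁     : ∀ {A} {h₁ : A ⇒ X} {h₂ : A ⇒ Y}
                            (eq : f ∘ h₁ ≈ g ∘ h₂) →
                            p₁ ∘ universal h₁ h₂ eq ≈ h₁
      p₂∘universal≈h₂     : ∀ {A} {h₁ : A ⇒ X} {h₂ : A ⇒ Y}
                            (eq : f ∘ h₁ ≈ g ∘ h₂) →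
                            p₂ ∘ universal h₁ h₂ eq ≈ h₂
      unique              : ∀ {A} {h₁ : A ⇒ X} {h₂ : A ⇒ Y} {u : A ⇒ P}
                            (eq : f ∘ h₁ ≈ g ∘ h₂) →
                            p₁ ∘ u ≈ h₁ → p₂ ∘ u ≈ h₂ →
                            u ≈ universal h₁ h₂ eq

  record Pullback {X Y Z : Obj} (f : X ⇒ Z) (g : Y ⇒ Z) : Set (o ⊔ ℓ ⊔ e) where
    field
      {P}        : Obj
      p₁         : P ⇒ X
      p₂         : P ⇒ Y
      isPullback : IsPullback p₁ p₂ f g

  record Coproduct (A B : Obj) : Set (o ⊔ ℓ ⊔ e) where
    field
      A+B     : Obj
      i₁      : A ⇒ A+B
      i₂      : B ⇒ A+B
      [_,_]   : ∀ {X} → A ⇒ X → B ⇒ X → A+B ⇒ X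
      inject₁ : ∀ {X} {f : A ⇒ X} {g : B ⇒ X} → [ f , g ] ∘ i₁ ≈ f
      inject₂ : ∀ {X} {f : A ⇒ X} {g : B ⇒ X} → [ f , g ] ∘ i₂ ≈ g
      unique  : ∀ {X} {f : A ⇒ X} {g : B ⇒ X} {u : A+B ⇒ X} →
                u ∘ i₁ ≈ f → u ∘ i₂ ≈ g → u ≈ [ f , g ]

  record BinaryCoproducts : Set (o ⊔ ℓ ⊔ e) where
    field
      coproduct : ∀ A B → Coproduct A B

    _+_ : Obj → Obj → Obj
    A + B = Coproduct.A+B (coproduct A B)

    _+₁_ : ∀ {A B C D} → A ⇒ C → B ⇒ D → (A + B) ⇒ (C + D)
    _+₁_ {A} {B} {C} {D} f g = AB.[ CD.i₁ ∘ f , CD.i₂ ∘ g ]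
      where
        module AB = Coproduct (coproduct A B)
        module CD = Coproduct (coproduct C D)

  MorphismClass : (p : Level) → Set (o ⊔ ℓ ⊔ suc p)
  MorphismClass p = ∀ {A B} → A ⇒ B → Set p

  CompatibleWith : BinaryCoproducts → MorphismClass p → Set (o ⊔ ℓ ⊔ p)
  CompatibleWith coproducts 𝓜 =
    ∀ {A B C D} {f : A ⇒ C} {g : B ⇒ D} → 𝓜 f → 𝓜 g → 𝓜 (f +₁ g)
    where open BinaryCoproducts coproducts

  -- The square (m , f , g , n) is the bottom face of the cube, the primed
  -- square its top face, and a, b, c, d are the vertical morphisms.  The back
  -- faces are those containing a, the front faces those containing d.
  IsWeakVanKampen : MorphismClass p → ∀ {A B C D : Obj} →
                    A ⇒ B → A ⇒ C → B ⇒ D → C ⇒ D → Set (o ⊔ ℓ ⊔ e ⊔ p)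
  IsWeakVanKampen 𝓜 {A} {B} {C} {D} m f g n =
    ∀ {A′ B′ C′ D′ : Obj}
      {m′ : A′ ⇒ B′} {f′ : A′ ⇒ C′} {g′ : B′ ⇒ D′} {n′ : C′ ⇒ D′}
      {a : A′ ⇒ A} {b : B′ ⇒ B} {c : C′ ⇒ C} {d : D′ ⇒ D} →
    g′ ∘ m′ ≈ n′ ∘ f′ →
    d ∘ g′ ≈ g ∘ b →
    d ∘ n′ ≈ n ∘ c →
    IsPullback m′ a b m →
    IsPullback f′ a c f →
    𝓜 f ⊎ (𝓜 b × 𝓜 c × 𝓜 d) →
    IsPushout m′ f′ g′ n′ ⇔ (IsPullback g′ b d g × IsPullback n′ c d n)

  record IsWeakAdhesiveHLR (𝓜 : MorphismClass p) : Set (o ⊔ ℓ ⊔ e ⊔ p) where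
    field
      -- A class of morphisms is a predicate up to _≈_.
      𝓜-resp-≈        : ∀ {A B} {f g : A ⇒ B} → f ≈ g → 𝓜 f → 𝓜 g
      𝓜-mono          : ∀ {A B} {f : A ⇒ B} → 𝓜 f → Mono f

      𝓜-iso           : ∀ {A B} {f : A ⇒ B} → IsIso f → 𝓜 f
      𝓜-∘             : ∀ {A B C} {g : B ⇒ C} {f : A ⇒ B} →
                        𝓜 g → 𝓜 f → 𝓜 (g ∘ f)
      𝓜-decompose     : ∀ {A B C} {g : B ⇒ C} {f : A ⇒ B} →
                        𝓜 (g ∘ f) → 𝓜 g → 𝓜 f

      pushout         : ∀ {A B C} (m : A ⇒ B) (f : A ⇒ C) → 𝓜 m → Pushout m f
      pullback        : ∀ {X Y Z} (m : X ⇒ Z) (f : Y ⇒ Z) → 𝓜 m → Pullback m f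
      pushout-stable  : ∀ {A B C D} {m : A ⇒ B} {f : A ⇒ C}
                        {i₁ : B ⇒ D} {i₂ : C ⇒ D} →
                        IsPushout m f i₁ i₂ → 𝓜 m → 𝓜 i₂
      pullback-stable : ∀ {P X Y Z} {p₁ : P ⇒ X} {p₂ : P ⇒ Y}
                        {m : X ⇒ Z} {f : Y ⇒ Z} →
                        IsPullback p₁ p₂ m f → 𝓜 m → 𝓜 p₂

      weakVanKampen   : ∀ {A B C D} {m : A ⇒ B} {f : A ⇒ C}
                        {g : B ⇒ D} {n : C ⇒ D} →
                        𝓜 m → IsPushout m f g n → IsWeakVanKampen 𝓜 m f g n

  record WeakSpan : Set (o ⊔ ℓ) where
    field
      {L K I R} : Obj
      l         : K ⇒ L
      i         : I ⇒ K
      r         : I ⇒ R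

  record IsMWeakSpan (𝓜 : MorphismClass p) (ρ : WeakSpan) : Set p where
    open WeakSpan ρ
    field
      l∈𝓜 : 𝓜 l
      i∈𝓜 : 𝓜 i
      r∈𝓜 : 𝓜 r

module _ {𝓒 : Category o ℓ e} where
  open Category 𝓒

  -- The direct transformations of G by ρ with result H; the set Δ(G,ρ) is the
  -- sum of these types over all objects H.
  record DirectTransformation (G : Obj) (ρ : WeakSpan 𝓒) (H : Obj)
         : Set (o ⊔ ℓ ⊔ e) where
    open WeakSpan ρ public
    field
      {D}        : Obj
      m          : L ⇒ G
      k          : K ⇒ D
      f          : D ⇒ G
      g          : D ⇒ H
      n          : R ⇒ H
      isPushoutG : IsPushout 𝓒 l k m f
      isPushoutH : IsPushout 𝓒 r (k ∘ i) n g

  module _ {G H₁ H₂ : Obj} {ρ₁ ρ₂ : WeakSpan 𝓒}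
           (γ₁ : DirectTransformation G ρ₁ H₁)
           (γ₂ : DirectTransformation G ρ₂ H₂) where
    private
      module γ₁ = DirectTransformation γ₁
      module γ₂ = DirectTransformation γ₂

    record ParallelIndependent : Set (ℓ ⊔ e) where
      field
        j₁       : γ₁.L ⇒ γ₂.D
        j₂       : γ₂.L ⇒ γ₁.D
        f₂∘j₁≈m₁ : γ₂.f ∘ j₁ ≈ γ₁.m
        f₁∘j₂≈m₂ : γ₁.f ∘ j₂ ≈ γ₂.m

    -- jca is the morphism from I_c to D_a usually written j with subscript c and
    -- superscript a.
    record ParallelCoherent : Set (ℓ ⊔ e) where
      field
        j12      : γ₁.I ⇒ γ₂.D
        j21      : γ₂.I ⇒ γ₁.D
        f₂∘j12≈  : γ₂.f ∘ j12 ≈ γ₁.f ∘ γ₁.k ∘ γ₁.i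
        f₁∘j21≈  : γ₁.f ∘ j21 ≈ γ₂.f ∘ γ₂.k ∘ γ₂.i

      j11 : γ₁.I ⇒ γ₁.D
      j11 = γ₁.k ∘ γ₁.i

      j22 : γ₂.I ⇒ γ₂.D
      j22 = γ₂.k ∘ γ₂.i

    record ParallelCoherentTransformation (H′ : Obj) : Set (o ⊔ ℓ ⊔ e) where
      field
        parallelCoherent : ParallelCoherent

      open ParallelCoherent parallelCoherent public

      field
        {D′}       : Obj
        e₁         : D′ ⇒ γ₁.D
        e₂         : D′ ⇒ γ₂.D
        isPullback : IsPullback 𝓒 e₁ e₂ γ₁.f γ₂.f

        -- d₁ and d₂ are determined up to _≈_ by these equations, by the
        -- universal property of the pullback.
        d₁         : γ₁.I ⇒ D′
        e₁∘d₁≈j11  : e₁ ∘ d₁ ≈ j11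
        e₂∘d₁≈j12  : e₂ ∘ d₁ ≈ j12
        d₂         : γ₂.I ⇒ D′
        e₁∘d₂≈j21  : e₁ ∘ d₂ ≈ j21
        e₂∘d₂≈j22  : e₂ ∘ d₂ ≈ j22

        {H′₁ H′₂}  : Obj
        g′₁        : D′ ⇒ H′₁
        n′₁        : γ₁.R ⇒ H′₁
        isPushout₁ : IsPushout 𝓒 γ₁.r d₁ n′₁ g′₁
        g′₂        : D′ ⇒ H′₂
        n′₂        : γ₂.R ⇒ H′₂
        isPushout₂ : IsPushout 𝓒 γ₂.r d₂ n′₂ g′₂

        h₁         : H′₁ ⇒ H′
        h₂         : H′₂ ⇒ H′
        isPushout′ : IsPushout 𝓒 g′₁ g′₂ h₁ h₂

{-# OPTIONS --safe #-}
-- Let p : K₂ → D′ be induced by j₂ ∘ l₂ and k₂.  Pulling the pushout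
-- G = L₂ +_{K₂} D₂ back along f₁ ∈ 𝓜, the weak van Kampen property gives
-- D₁ = L₂ +_{K₂} D′.  Since k₁ ∘ i₁ = e₁ ∘ d₁, H₁ is also the pushout of
-- g′₁ and e₁; pasting yields H₁ = L₂ +_{K₂} H′₁.  As e₂ is mono, d₂ = p ∘ i₂,
-- so pasting H′₂ = R₂ +_{I₂} D′ with H′ = H′₁ +_{D′} H′₂ gives
-- H′ = R₂ +_{I₂} H′₁.  Hence H′₁ is the context of the transformation of H₁.
module Submission where

open import Level using (Level)
open import Data.Product using (_,_)
open import Data.Sum using (inj₂)
open import Function.Bundles using (module Equivalence)
open import Relation.Binary.Bundles using (Setoid)
open import Relation.Binary.Structures using (IsEquivalence)
import Relation.Binary.Reasoning.Setoid as SetoidReasoning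
open import Defs

module _ {o ℓ e : Level} (𝓒 : Category o ℓ e) where
  open Category 𝓒
  private
    open module Equiv {A B} = IsEquivalence (equiv {A} {B})
      using (refl; sym; trans)

  hom-setoid : Obj → Obj → Setoid ℓ e
  hom-setoid A B = record { Carrier = A ⇒ B ; _≈_ = _≈_ ; isEquivalence = equiv }

  private
    open module HomReasoning {A B} = SetoidReasoning (hom-setoid A B)

  ∘-resp-≈ˡ : ∀ {A B C} {f h : B ⇒ C} {g : A ⇒ B} → f ≈ h → f ∘ g ≈ h ∘ g
  ∘-resp-≈ˡ eq = ∘-resp-≈ eq refl

  ∘-resp-≈ʳ : ∀ {A B C} {f : B ⇒ C} {g h : A ⇒ B} → g ≈ h → f ∘ g ≈ f ∘ h
  ∘-resp-≈ʳ eq = ∘-resp-≈ refl eq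

  pullˡ : ∀ {A B C D} {f : C ⇒ D} {g : B ⇒ C} {h : B ⇒ D} {k : A ⇒ B} →
          f ∘ g ≈ h → f ∘ g ∘ k ≈ h ∘ k
  pullˡ eq = trans (sym assoc) (∘-resp-≈ˡ eq)

  id-isIso : ∀ {A} → IsIso 𝓒 (id {A})
  id-isIso = record { inv = id ; isoˡ = identityˡ ; isoʳ = identityˡ }

  id-mono : ∀ {A} → Mono 𝓒 (id {A})
  id-mono g h eq = trans (sym identityˡ) (trans eq identityˡ)

  -- For a cone `(h₁ , h₂)`, `v ∘ u ∘ h₂ ≈ w ∘ h₂ ≈ v ∘ h₁`, and cancelling `v` shows that `h₂` is
  -- itself the mediating morphism. This supplies every cube face with an identity edge in
  -- `pushout-restrict`.
  mono-factor-isPullback : ∀ {A B C} {u : A ⇒ B} {v : B ⇒ C} {w : A ⇒ C} →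
                           Mono 𝓒 v → v ∘ u ≈ w → IsPullback 𝓒 u id v w
  mono-factor-isPullback {u = u} {v} {w} v-mono vu≈w = record
    { commute         = trans vu≈w (sym identityʳ)
    ; universal       = λ _ h₂ _ → h₂
    ; p₁∘universal≈h₁ = λ {_} {h₁} {h₂} eq →
        v-mono (u ∘ h₂) h₁ (trans (pullˡ vu≈w) (sym eq))
    ; p₂∘universal≈h₂ = λ _ → identityˡ
    ; unique          = λ _ _ id∘x≈h₂ → trans (sym identityˡ) id∘x≈h₂
    }

  pushout-joint-epi : ∀ {A B C D X} {f : A ⇒ B} {g : A ⇒ C}
                      {i₁ : B ⇒ D} {i₂ : C ⇒ D} → IsPushout 𝓒 f g i₁ i₂ →
                      {u v : D ⇒ X} → u ∘ i₁ ≈ v ∘ i₁ → u ∘ i₂ ≈ v ∘ i₂ → u ≈ v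
  pushout-joint-epi {f = f} {g} {i₁} {i₂} po {u} {v} eq₁ eq₂ =
    trans (unique cocone eq₁ eq₂) (sym (unique cocone refl refl))
    where
    open IsPushout po
    cocone : (v ∘ i₁) ∘ f ≈ (v ∘ i₂) ∘ g
    cocone = trans assoc (trans (∘-resp-≈ʳ commute) (sym assoc))

  pushout-sym : ∀ {A B C D} {f : A ⇒ B} {g : A ⇒ C} {i₁ : B ⇒ D} {i₂ : C ⇒ D} →
                IsPushout 𝓒 f g i₁ i₂ → IsPushout 𝓒 g f i₂ i₁
  pushout-sym po = record
    { commute         = sym commute
    ; universal       = λ h₁ h₂ eq → universal h₂ h₁ (sym eq)
    ; universal∘i₁≈h₁ = λ eq → universal∘i₂≈h₂ (sym eq)
    ; universal∘i₂≈h₂ = λ eq → universal∘i₁≈h₁ (sym eq)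
    ; unique          = λ eq eq₁ eq₂ → unique (sym eq) eq₂ eq₁
    }
    where open IsPushout po

  pushout-resp-≈ʳ : ∀ {A B C D} {f : A ⇒ B} {g g′ : A ⇒ C}
                    {i₁ : B ⇒ D} {i₂ : C ⇒ D} → g ≈ g′ →
                    IsPushout 𝓒 f g i₁ i₂ → IsPushout 𝓒 f g′ i₁ i₂
  pushout-resp-≈ʳ {B = B} {C} {f = f} {g} {g′} g≈g′ po = record
    { commute         = trans commute (∘-resp-≈ʳ g≈g′)
    ; universal       = λ h₁ h₂ eq → universal h₁ h₂ (adjust eq)
    ; universal∘i₁≈h₁ = λ eq → universal∘i₁≈h₁ (adjust eq)
    ; universal∘i₂≈h₂ = λ eq → universal∘i₂≈h₂ (adjust eq)
    ; unique          = λ eq → unique (adjust eq)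
    }
    where
    open IsPushout po
    adjust : ∀ {X} {x : B ⇒ X} {y : C ⇒ X} → x ∘ f ≈ y ∘ g′ → x ∘ f ≈ y ∘ g
    adjust eq = trans eq (∘-resp-≈ʳ (sym g≈g′))

  pushout-resp-≈ⁱ : ∀ {A B C D} {f : A ⇒ B} {g : A ⇒ C}
                    {i₁ i₁′ : B ⇒ D} {i₂ : C ⇒ D} → i₁ ≈ i₁′ →
                    IsPushout 𝓒 f g i₁ i₂ → IsPushout 𝓒 f g i₁′ i₂
  pushout-resp-≈ⁱ i₁≈i₁′ po = record
    { commute         = trans (∘-resp-≈ˡ (sym i₁≈i₁′)) commute
    ; universal       = universal
    ; universal∘i₁≈h₁ = λ eq → trans (∘-resp-≈ʳ (sym i₁≈i₁′)) (universal∘i₁≈h₁ eq)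
    ; universal∘i₂≈h₂ = universal∘i₂≈h₂
    ; unique          = λ eq eq₁ → unique eq (trans (∘-resp-≈ʳ i₁≈i₁′) eq₁)
    }
    where open IsPushout po

  module _ {A B C D E F : Obj} {f : A ⇒ B} {g : A ⇒ C} {i₁ : B ⇒ D} {i₂ : C ⇒ D}
           {h : C ⇒ E} {j₁ : D ⇒ F} {j₂ : E ⇒ F}
           (left : IsPushout 𝓒 f g i₁ i₂) where
    private module left = IsPushout left

    pushout-paste : IsPushout 𝓒 i₂ h j₁ j₂ →
                    IsPushout 𝓒 f (h ∘ g) (j₁ ∘ i₁) j₂
    pushout-paste right = record
      { commute         = begin
          (j₁ ∘ i₁) ∘ f ≈⟨ assoc ⟩
          j₁ ∘ i₁ ∘ f   ≈⟨ ∘-resp-≈ʳ left.commute ⟩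
          j₁ ∘ i₂ ∘ g   ≈⟨ pullˡ right.commute ⟩
          (j₂ ∘ h) ∘ g  ≈⟨ assoc ⟩
          j₂ ∘ h ∘ g    ∎
      ; universal       = λ x y eq → right.universal (inner eq) y (inner-commute eq)
      ; universal∘i₁≈h₁ = λ eq →
          trans (pullˡ (right.universal∘i₁≈h₁ (inner-commute eq)))
                (left.universal∘i₁≈h₁ (shift eq))
      ; universal∘i₂≈h₂ = λ eq → right.universal∘i₂≈h₂ (inner-commute eq)
      ; unique          = λ {_} {x} {y} {u} eq eq₁ eq₂ →
          right.unique (inner-commute eq)
            (left.unique (shift eq) (trans assoc eq₁)
              (begin
                (u ∘ j₁) ∘ i₂ ≈⟨ assoc ⟩
                u ∘ j₁ ∘ i₂   ≈⟨ ∘-resp-≈ʳ right.commute ⟩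
                u ∘ j₂ ∘ h    ≈⟨ pullˡ eq₂ ⟩
                y ∘ h         ∎))
            eq₂
      }
      where
      module right = IsPushout right

      shift : ∀ {X} {x : B ⇒ X} {y : E ⇒ X} →
              x ∘ f ≈ y ∘ h ∘ g → x ∘ f ≈ (y ∘ h) ∘ g
      shift eq = trans eq (sym assoc)

      -- A cocone on the outer rectangle is turned into one on the right square: its leg from `D` is
      -- induced by `x` and `y ∘ h`.
      inner : ∀ {X} {x : B ⇒ X} {y : E ⇒ X} → x ∘ f ≈ y ∘ h ∘ g → D ⇒ X
      inner {_} {x} {y} eq = left.universal x (y ∘ h) (shift eq)

      inner-commute : ∀ {X} {x : B ⇒ X} {y : E ⇒ X} (eq : x ∘ f ≈ y ∘ h ∘ g) →
                      inner eq ∘ i₂ ≈ y ∘ h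
      inner-commute eq = left.universal∘i₂≈h₂ (shift eq)

    -- A cocone `(x , y)` on the right square extends to the outer one by restricting `x` along
    -- `i₁`. The outer mediating morphism, composed with `j₁`, agrees with `x` on both `i₁` and
    -- `i₂`, which are jointly epic.
    pushout-cancel : IsPushout 𝓒 f (h ∘ g) (j₁ ∘ i₁) j₂ → j₁ ∘ i₂ ≈ j₂ ∘ h →
                     IsPushout 𝓒 i₂ h j₁ j₂
    pushout-cancel outer comm = record
      { commute         = comm
      ; universal       = λ x y eq → outer.universal (x ∘ i₁) y (extend eq)
      ; universal∘i₁≈h₁ = λ {_} {x} {y} eq → pushout-joint-epi left
          (trans assoc (outer.universal∘i₁≈h₁ (extend eq)))
          (begin
            (outer.universal (x ∘ i₁) y (extend eq) ∘ j₁) ∘ i₂ ≈⟨ assoc ⟩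
            outer.universal (x ∘ i₁) y (extend eq) ∘ j₁ ∘ i₂   ≈⟨ ∘-resp-≈ʳ comm ⟩
            outer.universal (x ∘ i₁) y (extend eq) ∘ j₂ ∘ h
              ≈⟨ pullˡ (outer.universal∘i₂≈h₂ (extend eq)) ⟩
            y ∘ h                                              ≈⟨ eq ⟨
            x ∘ i₂                                             ∎)
      ; universal∘i₂≈h₂ = λ eq → outer.universal∘i₂≈h₂ (extend eq)
      ; unique          = λ eq eq₁ eq₂ →
          outer.unique (extend eq) (pullˡ eq₁) eq₂
      }
      where
      module outer = IsPushout outer

      extend : ∀ {X} {x : D ⇒ X} {y : E ⇒ X} →
               x ∘ i₂ ≈ y ∘ h → (x ∘ i₁) ∘ f ≈ y ∘ h ∘ g
      extend {_} {x} {y} eq = begin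
        (x ∘ i₁) ∘ f ≈⟨ assoc ⟩
        x ∘ i₁ ∘ f   ≈⟨ ∘-resp-≈ʳ left.commute ⟩
        x ∘ i₂ ∘ g   ≈⟨ pullˡ eq ⟩
        (y ∘ h) ∘ g  ≈⟨ assoc ⟩
        y ∘ h ∘ g    ∎

  module _ {p : Level} {𝓜 : MorphismClass 𝓒 p} (hlr : IsWeakAdhesiveHLR 𝓒 𝓜) where
    open IsWeakAdhesiveHLR hlr

    -- Apply the weak van Kampen property to the cube with identities above `A` and `B` and with
    -- `c`, `d` above `C` and `D`. Three side faces are pullbacks because `id`, `c` and `d` are
    -- mono; the fourth is `pb`.
    pushout-restrict :
      ∀ {A B C D C′ D′} {m : A ⇒ B} {f : A ⇒ C} {g : B ⇒ D} {n : C ⇒ D}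
        {d : D′ ⇒ D} {n′ : C′ ⇒ D′} {c : C′ ⇒ C} {f′ : A ⇒ C′} {g′ : B ⇒ D′} →
      𝓜 m → 𝓜 d → IsPushout 𝓒 m f g n → IsPullback 𝓒 n′ c d n →
      d ∘ g′ ≈ g → n′ ∘ f′ ≈ g′ ∘ m → c ∘ f′ ≈ f →
      IsPushout 𝓒 m f′ g′ n′
    pushout-restrict m∈𝓜 d∈𝓜 po pb dg′≈g n′f′≈g′m cf′≈f =
      Equivalence.from
        (weakVanKampen m∈𝓜 po
          (sym n′f′≈g′m)
          (trans dg′≈g (sym identityʳ))
          (IsPullback.commute pb)
          (mono-factor-isPullback id-mono identityˡ)
          (mono-factor-isPullback (𝓜-mono c∈𝓜) cf′≈f)
          -- Nothing places `f` in `𝓜`, so the alternative on the vertical morphisms is taken.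
          (inj₂ (𝓜-iso id-isIso , c∈𝓜 , d∈𝓜)))
        (mono-factor-isPullback (𝓜-mono d∈𝓜) dg′≈g , pb)
      where
      c∈𝓜 = pullback-stable pb d∈𝓜

corollary4p6 : ∀ {o ℓ e p : Level}
    (𝓒 : Category o ℓ e) (𝓜 : MorphismClass 𝓒 p) →
    IsWeakAdhesiveHLR 𝓒 𝓜 →
    (coproducts : BinaryCoproducts 𝓒) → CompatibleWith 𝓒 coproducts 𝓜 →
    (ρ₁ ρ₂ : WeakSpan 𝓒) → IsMWeakSpan 𝓒 𝓜 ρ₁ → IsMWeakSpan 𝓒 𝓜 ρ₂ →
    (G H₁ H₂ H′ : Category.Obj 𝓒)
    (γ₁ : DirectTransformation G ρ₁ H₁)
    (γ₂ : DirectTransformation G ρ₂ H₂) →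
    ParallelIndependent γ₁ γ₂ →
    ParallelCoherentTransformation γ₁ γ₂ H′ →
    DirectTransformation H₁ ρ₂ H′
corollary4p6 𝓒 𝓜 hlr _ _ ρ₁ ρ₂ ρ₁∈𝓜 ρ₂∈𝓜 G H₁ H₂ H′ γ₁ γ₂ independent transformation = record
  { D          = T.H′₁
  ; m          = γ₁.g ∘ j₂
  ; k          = T.g′₁ ∘ p
  ; f          = q
  ; g          = T.h₁
  ; n          = T.h₂ ∘ T.n′₂
  -- The two squares are glued along `T.e₁`.
  ; isPushoutG = pushout-paste 𝓒 D₁-isPushout (pushout-sym 𝓒 H₁-isPushout)
  -- Gluing along `T.g′₂` yields the leg `T.g′₁ ∘ T.d₂`, which must be rewritten to factor through
  -- `γ₂.i`.
  ; isPushoutH = pushout-resp-≈ʳ 𝓒 g′₁d₂≈g′₁pi₂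
      (pushout-paste 𝓒 T.isPushout₂ (pushout-sym 𝓒 T.isPushout′))
  }
  where
  open Category 𝓒
  open module ≈ {A B} = IsEquivalence (equiv {A} {B}) using (sym; trans)
  open IsWeakAdhesiveHLR hlr
  open ParallelIndependent independent
  module γ₁ = DirectTransformation γ₁
  module γ₂ = DirectTransformation γ₂
  module T = ParallelCoherentTransformation transformation
  module D′ = IsPullback T.isPullback
  module H′₁ = IsPushout T.isPushout₁

  f₁∈𝓜 : 𝓜 γ₁.f
  f₁∈𝓜 = pushout-stable γ₁.isPushoutG (IsMWeakSpan.l∈𝓜 ρ₁∈𝓜)

  f₁j₂l₂≈f₂k₂ : γ₁.f ∘ j₂ ∘ γ₂.l ≈ γ₂.f ∘ γ₂.k
  f₁j₂l₂≈f₂k₂ = trans (pullˡ 𝓒 f₁∘j₂≈m₂) (IsPushout.commute γ₂.isPushoutG)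

  p : γ₂.K ⇒ T.D′
  p = D′.universal (j₂ ∘ γ₂.l) γ₂.k f₁j₂l₂≈f₂k₂

  e₂p≈k₂ : T.e₂ ∘ p ≈ γ₂.k
  e₂p≈k₂ = D′.p₂∘universal≈h₂ f₁j₂l₂≈f₂k₂

  -- Parallel independence enters here: `j₂` lifts `γ₂.m` through `γ₁.f`, so pulling back along
  -- `γ₁.f` leaves `γ₂.L` and `γ₂.K` unchanged and replaces only `γ₂.D` by `T.D′`.
  D₁-isPushout : IsPushout 𝓒 γ₂.l p j₂ T.e₁
  D₁-isPushout = pushout-restrict 𝓒 hlr (IsMWeakSpan.l∈𝓜 ρ₂∈𝓜) f₁∈𝓜
    γ₂.isPushoutG T.isPullback f₁∘j₂≈m₂ (D′.p₁∘universal≈h₁ f₁j₂l₂≈f₂k₂) e₂p≈k₂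

  n₁r₁≈g₁e₁d₁ : γ₁.n ∘ γ₁.r ≈ (γ₁.g ∘ T.e₁) ∘ T.d₁
  n₁r₁≈g₁e₁d₁ = trans (IsPushout.commute γ₁.isPushoutH)
    (trans (∘-resp-≈ʳ 𝓒 (sym T.e₁∘d₁≈j11)) (sym assoc))

  q : T.H′₁ ⇒ H₁
  q = H′₁.universal γ₁.n (γ₁.g ∘ T.e₁) n₁r₁≈g₁e₁d₁

  -- The pushout defining `H₁` has legs `γ₁.r` and `T.e₁ ∘ T.d₁`; cancelling the pushout of `γ₁.r`
  -- and `T.d₁` leaves this square.
  H₁-isPushout : IsPushout 𝓒 T.g′₁ T.e₁ q γ₁.g
  H₁-isPushout = pushout-cancel 𝓒 T.isPushout₁
    (pushout-resp-≈ⁱ 𝓒 (sym (H′₁.universal∘i₁≈h₁ n₁r₁≈g₁e₁d₁))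
      (pushout-resp-≈ʳ 𝓒 (sym T.e₁∘d₁≈j11) γ₁.isPushoutH))
    (H′₁.universal∘i₂≈h₂ n₁r₁≈g₁e₁d₁)

  -- The morphism `T.j21` is not assumed to be `j₂ ∘ γ₂.l ∘ γ₂.i`, so the comparison is made after
  -- `T.e₂`, where both sides become `γ₂.k ∘ γ₂.i`. As a pullback of `γ₁.f`, `T.e₂` lies in `𝓜` and
  -- can be cancelled.
  d₂≈pi₂ : T.d₂ ≈ p ∘ γ₂.i
  d₂≈pi₂ = 𝓜-mono (pullback-stable T.isPullback f₁∈𝓜) _ _
    (trans T.e₂∘d₂≈j22 (sym (pullˡ 𝓒 e₂p≈k₂)))

  g′₁d₂≈g′₁pi₂ : T.g′₁ ∘ T.d₂ ≈ (T.g′₁ ∘ p) ∘ γ₂.i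
  g′₁d₂≈g′₁pi₂ = trans (∘-resp-≈ʳ 𝓒 d₂≈pi₂) (sym assoc)
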